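{- Let $n \geq 4$ be an integer. Then the square $Q_n^2$ of the hypercube $Q_n$ is a distance-transitive graph.
   Context: All graphs are finite, simple and undirected. The hypercube $Q_n$ is the graph with vertex set $\{0,1\}^n$ in which two $n$-tuples are adjacent if and only if they differ in precisely one coordinate. For a graph $\Gamma=(V,E)$, the square $\Gamma^2$ is the simple graph with vertex set $V$ in which two distinct vertices are adjacent if and only if their distance in $\Gamma$ is at most two. A graph $\Gamma$ is distance-transitive if for all vertices $u,v,x,y$ of $\Gamma$ such that $d(u,v)=d(x,y)$, where $d$ is the graph distance in $\Gamma$, there is an automorphism $\pi$ of $\Gamma$ such that $\pi(u)=x$ and $\pi(v)=y$. -}

module Defs where

open import Data.Bool using (Bool)
import Data.Bool.Properties as Bool
open import Data.Fin using (Fin; zero)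
import Data.Fin.Properties as Fin
open import Data.Nat using (ℕ; zero; suc; _<_; _≤_; _^_; s≤s)
open import Data.Nat.Properties using (allUpTo?; anyUpTo?)
open import Data.Product using (∃; ∃!; ∃-syntax; _×_; _,_)
open import Data.Product.Function.NonDependent.Propositional using (_×-↔_)
open import Data.Vec using (Vec; []; _∷_; lookup)
open import Function using (_∘_; _↔_; _⇔_; mk↔ₛ′; Inverse)
open import Function.Properties.Inverse using (↔-sym; ↔-trans; Inverse⇒Injection)
open import Relation.Binary.Definitions using (Symmetric; Irreflexive; Decidable; DecidableEquality)
open import Relation.Binary.PropositionalEquality using (_≡_; _≢_; refl; sym; subst; ≢-sym)
open import Relation.Nullary using (¬_; Dec)
open import Relation.Nullary.Decidable using (map′; ¬?; _×-dec_; _→-dec_)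
import Relation.Unary as U

record Graph : Set₁ where
  field
    V          : Set
    Adj        : V → V → Set
    order      : ℕ
    enum       : V ↔ Fin order
    adj-sym    : Symmetric Adj
    adj-irrefl : Irreflexive _≡_ Adj
    adj?       : Decidable Adj

open Graph using (V; Adj) public

module _ (G : Graph) where

  data Walk : ℕ → V G → V G → Set where
    []  : ∀ {u} → Walk 0 u u
    _∷_ : ∀ {k u v w} → Adj G u v → Walk k v w → Walk (suc k) u w

  -- d(u , v) = k. When u and v lie in different components this holds for no k.
  IsDistance : V G → V G → ℕ → Set
  IsDistance u v k = Walk k u v × (∀ {j} → j < k → ¬ Walk j u v)

  -- d(u , v) = d(x , y), as elements of ℕ ∪ {∞}.
  EqualDistance : (u v x y : V G) → Set
  EqualDistance u v x y = ∀ k → IsDistance u v k ⇔ IsDistance x y k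

  SquareAdj : V G → V G → Set
  SquareAdj u v = u ≢ v × ∃[ k ] (k ≤ 2 × IsDistance u v k)

  IsAutomorphism : V G ↔ V G → Set
  IsAutomorphism π = ∀ u v → Adj G u v ⇔ Adj G (Inverse.to π u) (Inverse.to π v)

  DistanceTransitive : Set
  DistanceTransitive =
    ∀ (u v x y : V G) → EqualDistance u v x y →
    ∃[ π ] (IsAutomorphism π × Inverse.to π u ≡ x × Inverse.to π v ≡ y)

module _ (G : Graph) where
  open Graph G using (enum; adj-sym; adj?)

  private
    _≟_ : DecidableEquality (V G)
    _≟_ = Fin.inj⇒≟ (Inverse⇒Injection enum)

    any? : {P : V G → Set} → U.Decidable P → Dec (∃ P)
    any? {P} P? = map′
      (λ (i , p) → Inverse.from enum i , p)
      (λ (v , p) → Inverse.to enum v , subst P (sym (Inverse.strictlyInverseʳ enum v)) p)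
      (Fin.any? (P? ∘ Inverse.from enum))

    walk? : ∀ k u v → Dec (Walk G k u v)
    walk? zero    u v = map′ (λ { refl → [] }) (λ { [] → refl }) (u ≟ v)
    walk? (suc k) u w = map′
      (λ (_ , a , p) → a ∷ p)
      (λ { (a ∷ p) → _ , a , p })
      (any? λ v → adj? u v ×-dec walk? k v w)

    snoc : ∀ {k u v w} → Walk G k u v → Adj G v w → Walk G (suc k) u w
    snoc []      b = b ∷ []
    snoc (a ∷ p) b = a ∷ snoc p b

    reverse : ∀ {k u v} → Walk G k u v → Walk G k v u
    reverse []      = []
    reverse (a ∷ p) = snoc (reverse p) (adj-sym a)

    isDistance? : ∀ u v k → Dec (IsDistance G u v k)
    isDistance? u v k =
      walk? k u v ×-dec allUpTo? (λ j → ¬? (walk? j u v)) k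

  square : Graph
  square = record
    { V          = V G
    ; Adj        = SquareAdj G
    ; order      = Graph.order G
    ; enum       = enum
    ; adj-sym    = λ (u≢v , k , k≤2 , p , min) →
        ≢-sym u≢v , k , k≤2 , reverse p , λ j<k q → min j<k (reverse q)
    ; adj-irrefl = λ u≡v (u≢v , _) → u≢v u≡v
    ; adj?       = λ u v → ¬? (u ≟ v) ×-dec map′
        (λ { (k , s≤s k≤2 , d) → k , k≤2 , d })
        (λ (k , k≤2 , d) → k , s≤s k≤2 , d)
        (anyUpTo? (isDistance? u v) 3)
    }

HypercubeAdj : ∀ {n} → Vec Bool n → Vec Bool n → Set
HypercubeAdj u v = ∃! _≡_ (λ i → lookup u i ≢ lookup v i)

private
  vec-enum : ∀ n → Vec Bool n ↔ Fin (2 ^ n)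
  vec-enum zero    = mk↔ₛ′ (λ _ → zero) (λ _ → []) (λ { zero → refl }) (λ { [] → refl })
  vec-enum (suc n) =
    ↔-trans (mk↔ₛ′ (λ { (b ∷ v) → b , v }) (λ (b , v) → b ∷ v) (λ { (_ , _) → refl }) (λ { (_ ∷ _) → refl }))
    (↔-trans (↔-sym Fin.2↔Bool ×-↔ vec-enum n)
             (↔-sym Fin.*↔×))

  hypercubeAdj? : ∀ {n} → Decidable (HypercubeAdj {n})
  hypercubeAdj? u v = Fin.any? λ i → differ? i ×-dec
    map′ (λ f {j} → f j) (λ f j → f {j}) (Fin.all? λ j → differ? j →-dec (i Fin.≟ j))
    where
    differ? : ∀ i → Dec (lookup u i ≢ lookup v i)
    differ? i = ¬? (lookup u i Bool.≟ lookup v i)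

hypercube : ℕ → Graph
hypercube n = record
  { V          = Vec Bool n
  ; Adj        = HypercubeAdj
  ; order      = 2 ^ n
  ; enum       = vec-enum n
  ; adj-sym    = λ (i , d , uniq) → i , ≢-sym d , λ d′ → uniq (≢-sym d′)
  ; adj-irrefl = λ { refl (_ , d , _) → d refl }
  ; adj?       = hypercubeAdj?
  }

{-# OPTIONS --safe #-}

-- Distance in the square of a graph is ⌈ d /2⌉, so in Q_n² it is ⌈ ham /2⌉. Prepending a parity
-- bit identifies Q_n with the even vectors of length n + 1 and turns Hamming distance h into
-- 2 ⌈ h /2⌉. Hence every Hamming isometry of {0,1}^(n+1) that preserves evenness induces an
-- automorphism of Q_n², and coordinate permutations and translations already carry any pair of
-- vectors to any other pair at the same Hamming distance.
module Submission where

open import Defs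
open import Data.Bool using (Bool; true; false; not; _xor_)
open import Data.Bool.Properties as Bool using
  (not-involutive; not-distribˡ-xor; not-distribʳ-xor; xor-same; xor-assoc;
   xor-identityʳ; xor-annihilates-not)
open import Data.Fin using (zero; suc)
open import Data.Fin.Properties using (suc-injective)
open import Data.Nat using (ℕ; zero; suc; _+_; _*_; _≤_; _<_; _≥_; ⌈_/2⌉; z≤n; s≤s; z<s; s<s)
open import Data.Nat.Properties using
  (≤-refl; ≤-reflexive; ≤-trans; <-trans; m≤n⇒m≤1+n; n<1+n; ≤-<-trans; <-cmp;
   +-monoˡ-<; +-mono-≤; *-suc; *-cancelˡ-≡; <⇒≱)
open import Data.Product using (∃-syntax; _×_; _,_)
open import Data.Vec using (Vec; []; _∷_; lookup; replicate; tail)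
open import Data.Vec.Properties using (tabulate∘lookup; tabulate-cong)
open import Function using (_∘_; _↔_; _⇔_; mk↔ₛ′; mk⇔; Inverse; Equivalence)
open import Function.Properties.Inverse using (↔-refl; ↔-sym; ↔-trans)
open import Relation.Binary.Definitions using (tri<; tri≈; tri>)
open import Relation.Binary.PropositionalEquality using
  (_≡_; _≢_; refl; sym; trans; cong; cong₂; subst; module ≡-Reasoning)
open import Relation.Nullary using (contradiction)
open import Relation.Nullary.Decidable using (decidable-stable)

-- Distances in a graph and in its square

<⌈/2⌉⇒2*< : ∀ {j m} → j < ⌈ m /2⌉ → 2 * j < m
<⌈/2⌉⇒2*< {zero}  {suc m} _ = z<s
<⌈/2⌉⇒2*< {suc j} {suc (suc m)} (s≤s j<) =
  subst (_< 2 + m) (sym (*-suc 2 j)) (s<s (s<s (<⌈/2⌉⇒2*< j<)))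
<⌈/2⌉⇒2*< {suc j} {suc zero} (s≤s ())

module _ {G : Graph} where

  _++ʷ_ : ∀ {j k u v w} → Walk G j u v → Walk G k v w → Walk G (j + k) u w
  []      ++ʷ q = q
  (a ∷ p) ++ʷ q = a ∷ (p ++ʷ q)

  IsDistance-unique : ∀ {u v j k} → IsDistance G u v j → IsDistance G u v k → j ≡ k
  IsDistance-unique {j = j} {k} (p , min-p) (q , min-q) with <-cmp j k
  ... | tri< j<k _ _ = contradiction p (min-q j<k)
  ... | tri≈ _ j≡k _ = j≡k
  ... | tri> _ _ k<j = contradiction q (min-p k<j)

  -- Meant to be applied to the square itself, so that adjacency there becomes a statement about
  -- distance alone.
  Adj⇔IsDistance-1 : ∀ {u v} → Adj G u v ⇔ IsDistance G u v 1
  Adj⇔IsDistance-1 = mk⇔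
    (λ a → a ∷ [] , λ { z<s [] → Graph.adj-irrefl G refl a })
    (λ { (a ∷ [] , _) → a })

  -- Each edge of the square unfolds to a geodesic of `G` with at most two edges.
  Walk-square⇒Walk : ∀ {k u v} → Walk (square G) k u v → ∃[ j ] (j ≤ 2 * k × Walk G j u v)
  Walk-square⇒Walk [] = 0 , z≤n , []
  Walk-square⇒Walk {suc k} ((_ , i , i≤2 , p , _) ∷ q) with Walk-square⇒Walk q
  ... | j , j≤2k , r =
    i + j , ≤-trans (+-mono-≤ i≤2 j≤2k) (≤-reflexive (sym (*-suc 2 k))) , p ++ʷ r

  -- Any two consecutive edges of a geodesic join vertices at distance exactly two.
  IsDistance⇒Walk-square : ∀ {m u v} → IsDistance G u v m → Walk (square G) ⌈ m /2⌉ u v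
  IsDistance⇒Walk-square ([] , _) = []
  IsDistance⇒Walk-square d@(a ∷ [] , _) =
    ((λ u≡v → Graph.adj-irrefl G u≡v a) , 1 , s≤s z≤n , d) ∷ []
  IsDistance⇒Walk-square {suc (suc m)} (_∷_ {u = u} a (_∷_ {v = w} b p) , min) =
    (u≢w , 2 , ≤-refl , a ∷ b ∷ [] , λ j<2 q → min (+-monoˡ-< m j<2) (q ++ʷ p))
      ∷ IsDistance⇒Walk-square (p , λ j<m q → min (s<s (s<s j<m)) (a ∷ b ∷ q))
    where
    u≢w : u ≢ w
    u≢w refl = min (<-trans (n<1+n m) (n<1+n (suc m))) p

  -- A walk in the square with `j < ⌈ m /2⌉` edges would unfold to at most `2 * j < m` edges of `G`,
  -- against the minimality of `m`.
  IsDistance-square : ∀ {m u v} → IsDistance G u v m → IsDistance (square G) u v ⌈ m /2⌉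
  IsDistance-square d@(_ , min) = IsDistance⇒Walk-square d , λ j< q →
    let (_ , i≤2j , r) = Walk-square⇒Walk q in min (≤-<-trans i≤2j (<⌈/2⌉⇒2*< j<)) r

-- Hamming distance

bit : Bool → ℕ
bit false = 0
bit true  = 1

ham : ∀ {n} → Vec Bool n → Vec Bool n → ℕ
ham []      []      = 0
ham (a ∷ u) (b ∷ v) = bit (a xor b) + ham u v

ham-self : ∀ {n} (u : Vec Bool n) → ham u u ≡ 0
ham-self []      = refl
ham-self (a ∷ u) = cong₂ _+_ (cong bit (xor-same a)) (ham-self u)

ham≤n : ∀ {n} (u v : Vec Bool n) → ham u v ≤ n
ham≤n []      []      = z≤n
ham≤n (a ∷ u) (b ∷ v) with a xor b
... | false = m≤n⇒m≤1+n (ham≤n u v)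
... | true  = s≤s (ham≤n u v)

lookup-injective : ∀ {A : Set} {n} {u v : Vec A n} → (∀ i → lookup u i ≡ lookup v i) → u ≡ v
lookup-injective {u = u} {v} eq =
  trans (sym (tabulate∘lookup u)) (trans (tabulate-cong eq) (tabulate∘lookup v))

bit-xor-≤ : ∀ a b c → bit (a xor c) ≤ suc (bit (b xor c))
bit-xor-≤ a b c with a xor c
... | false = z≤n
... | true  = s≤s z≤n

ham-adj-≤ : ∀ {n} (u v w : Vec Bool n) → HypercubeAdj u v → ham u w ≤ suc (ham v w)
ham-adj-≤ (a ∷ u) (b ∷ v) (c ∷ w) (zero , _ , uniq)
  -- The heads are the only differing entries: a difference at `suc i` would give `zero ≡ suc i`.
  -- Hence the tails coincide, and the two heads change the distance by at most one.
  with refl ← lookup-injective {u = u} {v} (λ i → decidable-stable (lookup u i Bool.≟ lookup v i)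
                (λ d → contradiction (uniq {suc i} d) λ ()))
  = +-mono-≤ (bit-xor-≤ a b c) (≤-refl {ham u w})
ham-adj-≤ (a ∷ u) (b ∷ v) (c ∷ w) (suc i , d , uniq)
  with refl ← decidable-stable (a Bool.≟ b) (λ a≢b → contradiction (uniq {zero} a≢b) λ ())
  with a xor c | ham-adj-≤ u v w (i , d , λ {j} e → suc-injective (uniq {suc j} e))
... | false | le = le
... | true  | le = s≤s le

Walk⇒ham≤ : ∀ {n k} {u v : Vec Bool n} → Walk (hypercube n) k u v → ham u v ≤ k
Walk⇒ham≤ {u = u} [] = ≤-reflexive (ham-self u)
Walk⇒ham≤ {u = u} {v} (_∷_ {v = w} a p) = ≤-trans (ham-adj-≤ u w v a) (s≤s (Walk⇒ham≤ p))

HypercubeAdj-∷ : ∀ {n} a {u v : Vec Bool n} → HypercubeAdj u v → HypercubeAdj (a ∷ u) (a ∷ v)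
HypercubeAdj-∷ a (i , d , uniq) = suc i , d , λ
  { {zero} e → contradiction refl e ; {suc j} e → cong suc (uniq e) }

HypercubeAdj-head : ∀ {n a b} (u : Vec Bool n) → a ≢ b → HypercubeAdj (a ∷ u) (b ∷ u)
HypercubeAdj-head u a≢b = zero , a≢b , λ
  { {zero} _ → refl ; {suc j} e → contradiction refl e }

Walk-∷ : ∀ {n k} a {u v : Vec Bool n} →
         Walk (hypercube n) k u v → Walk (hypercube (suc n)) k (a ∷ u) (a ∷ v)
Walk-∷ a []      = []
Walk-∷ a (e ∷ p) = HypercubeAdj-∷ a e ∷ Walk-∷ a p

-- The walk flips the differing coordinates one at a time, from left to right.
ham-Walk : ∀ {n} (u v : Vec Bool n) → Walk (hypercube n) (ham u v) u v
ham-Walk []          []          = []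
ham-Walk (false ∷ u) (false ∷ v) = Walk-∷ false (ham-Walk u v)
ham-Walk (false ∷ u) (true  ∷ v) = HypercubeAdj-head u (λ ()) ∷ Walk-∷ true (ham-Walk u v)
ham-Walk (true  ∷ u) (false ∷ v) = HypercubeAdj-head u (λ ()) ∷ Walk-∷ false (ham-Walk u v)
ham-Walk (true  ∷ u) (true  ∷ v) = Walk-∷ true (ham-Walk u v)

IsDistance-hypercube : ∀ {n} (u v : Vec Bool n) → IsDistance (hypercube n) u v (ham u v)
IsDistance-hypercube u v = ham-Walk u v , λ j< p → <⇒≱ j< (Walk⇒ham≤ p)

IsDistance-hypercube² : ∀ {n} (u v : Vec Bool n) →
                        IsDistance (square (hypercube n)) u v ⌈ ham u v /2⌉
IsDistance-hypercube² u v = IsDistance-square (IsDistance-hypercube u v)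

-- Hamming isometries

Isometric : ∀ {n} → Vec Bool n ↔ Vec Bool n → Set
Isometric π = ∀ a b → ham (Inverse.to π a) (Inverse.to π b) ≡ ham a b

xor-involutiveˡ : ∀ c a → c xor (c xor a) ≡ a
xor-involutiveˡ c a = trans (sym (xor-assoc c c a)) (cong (_xor a) (xor-same c))

xor-translate : ∀ c a b → (c xor a) xor (c xor b) ≡ a xor b
xor-translate false a b = refl
xor-translate true  a b = xor-annihilates-not a b

Isometric-sym : ∀ {n} {π : Vec Bool n ↔ Vec Bool n} → Isometric π → Isometric (↔-sym π)
Isometric-sym {π = π} iso a b = trans (sym (iso (from a) (from b)))
  (cong₂ ham (strictlyInverseˡ a) (strictlyInverseˡ b))
  where open Inverse π

-- Ordered pairs in the same orbit of the group of Hamming isometries. Two pairs are compared by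
-- moving both to a normal form.
Congruent : ∀ {n} → (u v x y : Vec Bool n) → Set
Congruent u v x y = ∃[ π ] (Isometric π × Inverse.to π u ≡ x × Inverse.to π v ≡ y)

module _ {n : ℕ} {u v x y : Vec Bool n} where

  Congruent-sym : Congruent u v x y → Congruent x y u v
  Congruent-sym (π , iso , refl , refl) =
    ↔-sym π , Isometric-sym {π = π} iso
    , Inverse.strictlyInverseʳ π u , Inverse.strictlyInverseʳ π v

  Congruent-trans : ∀ {z w} → Congruent u v x y → Congruent x y z w → Congruent u v z w
  Congruent-trans (π , iso-π , refl , refl) (ρ , iso-ρ , refl , refl) =
    ↔-trans π ρ , (λ a b → trans (iso-ρ _ _) (iso-π a b)) , refl , refl

  -- The new coordinate is translated by `c`: `c = false` keeps it fixed, and `c = a` clears the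
  -- head of the first vector.
  Congruent-∷ : ∀ c a b → Congruent u v x y →
                Congruent (a ∷ u) (b ∷ v) ((c xor a) ∷ x) ((c xor b) ∷ y)
  Congruent-∷ c a b (π , iso , refl , refl) = mk↔ₛ′
    (λ { (a ∷ u) → (c xor a) ∷ to u })
    (λ { (a ∷ u) → (c xor a) ∷ from u })
    (λ { (a ∷ u) → cong₂ _∷_ (xor-involutiveˡ c a) (strictlyInverseˡ u) })
    (λ { (a ∷ u) → cong₂ _∷_ (xor-involutiveˡ c a) (strictlyInverseʳ u) })
    , (λ { (a ∷ u) (b ∷ v) → cong₂ _+_ (cong bit (xor-translate c a b)) (iso u v) })
    , refl , refl
    where open Inverse π

Congruent-refl : ∀ {n} {u v : Vec Bool n} → Congruent u v u v
Congruent-refl = ↔-refl , (λ _ _ → refl) , refl , refl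

bit-xor-swap : ∀ a b c d m →
  bit (b xor d) + (bit (a xor c) + m) ≡ bit (a xor c) + (bit (b xor d) + m)
bit-xor-swap a b c d m with a xor c | b xor d
... | false | _     = refl
... | true  | false = refl
... | true  | true  = refl

Congruent-swap : ∀ {n} a b c d (u v : Vec Bool n) →
                 Congruent (a ∷ b ∷ u) (c ∷ d ∷ v) (b ∷ a ∷ u) (d ∷ c ∷ v)
Congruent-swap a b c d u v = mk↔ₛ′
  swap swap (λ { (_ ∷ _ ∷ _) → refl }) (λ { (_ ∷ _ ∷ _) → refl })
  , (λ { (a ∷ b ∷ u) (c ∷ d ∷ v) → bit-xor-swap a b c d (ham u v) })
  , refl , refl
  where
  swap : ∀ {n} → Vec Bool (2 + n) → Vec Bool (2 + n)
  swap (a ∷ b ∷ u) = b ∷ a ∷ u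

0s : ∀ n → Vec Bool n
0s n = replicate n false

-- 1^k 0^(n - k), cut off at length n when k > n.
1s0s : ∀ n → ℕ → Vec Bool n
1s0s zero    _       = []
1s0s (suc n) zero    = false ∷ 1s0s n zero
1s0s (suc n) (suc k) = true ∷ 1s0s n k

-- Transpositions of neighbouring coordinates carry the leading `false` rightwards past the ones,
-- while the zero vector stays fixed. For `k > n` the cut-off would leave the right side with one
-- more `true` than the left.
Congruent-rotate : ∀ {n k} → k ≤ n →
  Congruent (0s (suc n)) (false ∷ 1s0s n k) (0s (suc n)) (1s0s (suc n) k)
Congruent-rotate z≤n = Congruent-refl
Congruent-rotate {suc n} {suc k} (s≤s k≤n) = Congruent-trans
  (Congruent-swap false false false true (0s n) (1s0s n k))
  (Congruent-∷ false false true (Congruent-rotate k≤n))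

-- Translation by `u` sends `u` to zero and `v` to a vector with `ham u v` ones, which are then
-- sorted to the front.
Congruent-normal : ∀ {n} (u v : Vec Bool n) → Congruent u v (0s n) (1s0s n (ham u v))
Congruent-normal [] [] = Congruent-refl
Congruent-normal {suc n} (a ∷ u) (b ∷ v)
  -- Translating the heads by `a` turns them into `a xor a`, which `eq` replaces by `false`, and
  -- `a xor b`. If the latter is `true` it extends the run of ones; if `false` it has to be rotated
  -- behind them.
  with a xor b | xor-same a | Congruent-∷ a a b (Congruent-normal u v)
... | true  | eq | c =
  subst (λ z → Congruent (a ∷ u) (b ∷ v) (z ∷ 0s n) (true ∷ 1s0s n (ham u v))) eq c
... | false | eq | c = Congruent-trans
  (subst (λ z → Congruent (a ∷ u) (b ∷ v) (z ∷ 0s n) (false ∷ 1s0s n (ham u v))) eq c)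
  (Congruent-rotate (ham≤n u v))

ham-homogeneous : ∀ {n} (u v x y : Vec Bool n) → ham u v ≡ ham x y → Congruent u v x y
ham-homogeneous {n} u v x y eq = Congruent-trans (Congruent-normal u v)
  (Congruent-sym (subst (λ k → Congruent x y (0s n) (1s0s n k)) (sym eq) (Congruent-normal x y)))

-- The parity extension

odd : ℕ → Bool
odd zero    = false
odd (suc n) = not (odd n)

bit-odd+n : ∀ n → bit (odd n) + n ≡ 2 * ⌈ n /2⌉
bit-odd+n 0 = refl
bit-odd+n 1 = refl
bit-odd+n (suc (suc n)) = begin
  bit (not (not (odd n))) + (2 + n)  ≡⟨ cong (λ b → bit b + (2 + n)) (not-involutive (odd n)) ⟩
  bit (odd n) + (2 + n)              ≡⟨ shift (odd n) ⟩
  2 + (bit (odd n) + n)              ≡⟨ cong (2 +_) (bit-odd+n n) ⟩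
  2 + 2 * ⌈ n /2⌉                    ≡⟨ *-suc 2 ⌈ n /2⌉ ⟨
  2 * suc ⌈ n /2⌉                    ∎
  where
  open ≡-Reasoning
  shift : ∀ b → bit b + (2 + n) ≡ 2 + (bit b + n)
  shift false = refl
  shift true  = refl

parity : ∀ {n} → Vec Bool n → Bool
parity []      = false
parity (a ∷ u) = a xor parity u

-- Modulo two, the Hamming distance is the weight of the coordinatewise sum, and weight is additive
-- modulo two.
odd-ham : ∀ {n} (u v : Vec Bool n) → odd (ham u v) ≡ parity u xor parity v
odd-ham []          []          = refl
odd-ham (false ∷ u) (false ∷ v) = odd-ham u v
odd-ham (false ∷ u) (true  ∷ v) =
  trans (cong not (odd-ham u v)) (not-distribʳ-xor (parity u) (parity v))
odd-ham (true  ∷ u) (false ∷ v) =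
  trans (cong not (odd-ham u v)) (not-distribˡ-xor (parity u) (parity v))
odd-ham (true  ∷ u) (true  ∷ v) =
  trans (odd-ham u v) (sym (xor-annihilates-not (parity u) (parity v)))

extend : ∀ {n} → Vec Bool n → Vec Bool (suc n)
extend u = parity u ∷ u

parity-extend : ∀ {n} (u : Vec Bool n) → parity (extend u) ≡ false
parity-extend u = xor-same (parity u)

-- The head of an even vector is the parity of its tail, so `tail` inverts `extend` on the even
-- vectors.
extend-tail : ∀ {n} (u : Vec Bool (suc n)) → parity u ≡ false → extend (tail u) ≡ u
extend-tail (a ∷ u) even = cong (_∷ u) (begin
  parity u                ≡⟨ xor-involutiveˡ a (parity u) ⟨
  a xor (a xor parity u)  ≡⟨ cong (a xor_) even ⟩
  a xor false             ≡⟨ xor-identityʳ a ⟩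
  a                       ∎)
  where open ≡-Reasoning

-- By `odd-ham` the parity bits differ exactly when `ham u v` is odd, which rounds the distance up
-- to an even number.
ham-extend : ∀ {n} (u v : Vec Bool n) → ham (extend u) (extend v) ≡ 2 * ⌈ ham u v /2⌉
ham-extend u v =
  trans (cong (λ b → bit b + ham u v) (sym (odd-ham u v))) (bit-odd+n (ham u v))

-- A vector is even exactly when its distance to an even vector is even, so a single even vector
-- with even image controls all the others.
isometry-preserves-even : ∀ {n} (π : Vec Bool n ↔ Vec Bool n) → Isometric π →
  ∀ {u} → parity u ≡ false → parity (Inverse.to π u) ≡ false →
  ∀ {w} → parity w ≡ false → parity (Inverse.to π w) ≡ false
isometry-preserves-even π iso {u} even-u even-πu {w} even-w = begin
  parity (to w)                    ≡⟨ cong (_xor parity (to w)) even-πu ⟨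
  parity (to u) xor parity (to w)  ≡⟨ odd-ham (to u) (to w) ⟨
  odd (ham (to u) (to w))          ≡⟨ cong odd (iso u w) ⟩
  odd (ham u w)                    ≡⟨ odd-ham u w ⟩
  parity u xor parity w            ≡⟨ cong₂ _xor_ even-u even-w ⟩
  false                            ∎
  where
  open ≡-Reasoning
  open Inverse π

module _ {n} (π : Vec Bool (suc n) ↔ Vec Bool (suc n)) (iso : Isometric π) (u : Vec Bool n)
         (even-πu : parity (Inverse.to π (extend u)) ≡ false) where
  open Inverse π

  private
    extend-to : ∀ w → extend (tail (to (extend w))) ≡ to (extend w)
    extend-to w = extend-tail (to (extend w))
      (isometry-preserves-even π iso (parity-extend u) even-πu (parity-extend w))

    extend-from : ∀ w → extend (tail (from (extend w))) ≡ from (extend w)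
    extend-from w = extend-tail (from (extend w))
      -- For the inverse, the even vector with even image is `to (extend u)`, which returns to
      -- `extend u`.
      (isometry-preserves-even (↔-sym π) (Isometric-sym {π = π} iso) even-πu
        (trans (cong parity (strictlyInverseʳ (extend u))) (parity-extend u)) (parity-extend w))

  -- This is `π` on the even vectors, read through `extend`. It may move the parity bit into another
  -- coordinate, so only the rounded half of the Hamming distance is sure to survive.
  restrict-even : Vec Bool n ↔ Vec Bool n
  restrict-even = mk↔ₛ′ (tail ∘ to ∘ extend) (tail ∘ from ∘ extend)
    (λ w → cong tail (trans (cong to (extend-from w)) (strictlyInverseˡ (extend w))))
    (λ w → cong tail (trans (cong from (extend-to w)) (strictlyInverseʳ (extend w))))

  restrict-even-⌈ham/2⌉ : ∀ a b →
    ⌈ ham a b /2⌉ ≡ ⌈ ham (Inverse.to restrict-even a) (Inverse.to restrict-even b) /2⌉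
  restrict-even-⌈ham/2⌉ a b = *-cancelˡ-≡ _ _ 2 (begin
    2 * ⌈ ham a b /2⌉                    ≡⟨ ham-extend a b ⟨
    ham (extend a) (extend b)            ≡⟨ iso (extend a) (extend b) ⟨
    ham (to (extend a)) (to (extend b))  ≡⟨ cong₂ ham (extend-to a) (extend-to b) ⟨
    ham (extend (σ a)) (extend (σ b))    ≡⟨ ham-extend (σ a) (σ b) ⟩
    2 * ⌈ ham (σ a) (σ b) /2⌉            ∎)
    where
    open ≡-Reasoning
    σ = Inverse.to restrict-even

-- `ham u v` and `ham x y` may differ by one, but the extended pairs are at equal distance, so
-- `ham-homogeneous` applies one dimension up.
⌈ham/2⌉-homogeneous : ∀ {n} (u v x y : Vec Bool n) → ⌈ ham u v /2⌉ ≡ ⌈ ham x y /2⌉ →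
  ∃[ σ ] ((∀ a b → ⌈ ham a b /2⌉ ≡ ⌈ ham (Inverse.to σ a) (Inverse.to σ b) /2⌉)
         × Inverse.to σ u ≡ x × Inverse.to σ v ≡ y)
⌈ham/2⌉-homogeneous u v x y eq
  with ham-homogeneous (extend u) (extend v) (extend x) (extend y)
         (trans (ham-extend u v) (trans (cong (2 *_) eq) (sym (ham-extend x y))))
... | π , iso , πu≡x , πv≡y =
  restrict-even π iso u even , restrict-even-⌈ham/2⌉ π iso u even , cong tail πu≡x , cong tail πv≡y
  where even = trans (cong parity πu≡x) (parity-extend x)

-- Distance-transitivity of the squared hypercube

Adj-hypercube²⇔ : ∀ {n} (u v : Vec Bool n) →
                  Adj (square (hypercube n)) u v ⇔ ⌈ ham u v /2⌉ ≡ 1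
Adj-hypercube²⇔ u v = mk⇔
  (λ a → IsDistance-unique (IsDistance-hypercube² u v) (Equivalence.to Adj⇔IsDistance-1 a))
  (λ eq → Equivalence.from Adj⇔IsDistance-1
            (subst (IsDistance _ u v) eq (IsDistance-hypercube² u v)))

theorem3p3 : (n : ℕ) → n ≥ 4 → DistanceTransitive (square (hypercube n))
theorem3p3 n _ u v x y equal
  -- Evaluating `equal` at the distance of `u` and `v` makes it the distance of `x` and `y` too;
  -- uniqueness of distance equates the two rounded halves.
  with ⌈ham/2⌉-homogeneous u v x y (IsDistance-unique
         (Equivalence.to (equal ⌈ ham u v /2⌉) (IsDistance-hypercube² u v))
         (IsDistance-hypercube² x y))
... | σ , preserves , σu≡x , σv≡y = σ , automorphism , σu≡x , σv≡y
  where
  automorphism : IsAutomorphism (square (hypercube n)) σ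
  automorphism a b = mk⇔
    (from (Adj-hypercube²⇔ _ _) ∘ trans (sym (preserves a b)) ∘ to (Adj-hypercube²⇔ a b))
    (from (Adj-hypercube²⇔ a b) ∘ trans (preserves a b) ∘ to (Adj-hypercube²⇔ _ _))
    where open Equivalence
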